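{- Let $\eta,x,y,s,t$ be parameters satisfying the relation $xs=yt$. For any $a_1,b_1\in\{0,1\}$ and $a_2,a_3,b_2,b_3\in\mathbb{Z}_{\ge0}$, the following equality of rational functions holds: $$\sum_{l_1,l_2,l_3}W^{\mathsf s}_{t,s}(a_3,a_2;l_3,l_2)\,w^{\mathsf s*}_{\eta x;\eta s}(l_3,l_1;b_3,a_1)\,w^{\mathsf s*}_{y;t}(l_2,b_1;b_2,l_1)$$ $$=\sum_{l_1,l_2,l_3}w^{\mathsf s*}_{\eta y;\eta t}(a_2,l_1;l_2,a_1)\,w^{\mathsf s*}_{x;s}(a_3,b_1;l_3,l_1)\,W^{\mathsf s}_{t,s}(l_3,l_2;b_3,b_2),$$ where the sums are over $l_1\in\{0,1\}$ and $l_2,l_3\in\mathbb{Z}_{\ge0}$.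
   Context: $q$ is a fixed generic parameter, $(x;q)_n:=\prod_{i=1}^n(1-xq^{i-1})$, $(x;q)_0:=1$. For $i,j,k,l\in\mathbb{Z}_{\ge0}$, $$W^{\mathsf s}_{t,s}(i,j;k,l):=\mathbf{1}_{i+j=k+l}\,\mathbf{1}_{i\ge l}\,s^{2l}t^{ -2l}\frac{(s^2/t^2;q)_{i-l}(t^2;q)_l}{(s^2;q)_i}\frac{(q;q)_i}{(q;q)_{i-l}(q;q)_l}.$$ For $i,k\in\mathbb{Z}_{\ge0}$ and $j,l\in\{0,1\}$, the dual weights $w^{\mathsf s*}_{u;s}(i,l;k,j)$ ($i$ bottom, $l$ right, $k$ top, $j$ left label) are, for $g\in\mathbb{Z}_{\ge0}$, $$w^{\mathsf s*}_{u;s}(g,0;g,0)=\frac{1-suq^g}{1-su},\qquad w^{\mathsf s*}_{u;s}(g,1;g+1,0)=\frac{ -s^{ -1}u(1-s^2q^g)}{1-su},$$ $$w^{\mathsf s*}_{u;s}(g,0;g-1,1)=\frac{1-q^g}{1-su},\qquad w^{\mathsf s*}_{u;s}(g,1;g,1)=\frac{q^g-s^{ -1}u}{1-su},$$ and $w^{\mathsf s*}_{u;s}(i,l;k,j)=0$ in all other cases. -}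

module Defs where

open import Algebra.Apartness.Bundles using (HeytingField; HeytingCommutativeRing)
open import Algebra.Bundles using (CommutativeRing)
open import Data.Bool.Base using (if_then_else_)
open import Data.Fin.Base using (Fin; toℕ)
open import Data.Fin.Patterns using (0F; 1F)
open import Data.Nat.Base as ℕ using (ℕ; zero; suc; _∸_; _≤_)
open import Data.Nat.Properties using (_≟_; _≤?_)
open import Data.Product.Base using (∃-syntax; _×_; proj₁)
open import Data.Sum.Base using (_⊎_)
open import Level using (Level)
open import Relation.Nullary.Decidable.Core using (Dec; does)

module Weights {c ℓ₁ ℓ₂ : Level} (F : HeytingField c ℓ₁ ℓ₂)
               (q : HeytingField.Carrier F) where

  open HeytingField F
  open CommutativeRing (HeytingCommutativeRing.commutativeRing heytingCommutativeRing)
    using (semiring)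
  open import Algebra.Properties.Semiring.Exp semiring public using (_^_)
  open import Algebra.Properties.Semiring.Sum semiring public using (sum-syntax)

  infix  9 _⁻¹[_]
  infixl 7 _/_[_]

  -- The library's witness of x # 0# is an inverse of x - 0#.
  _⁻¹[_] : (x : Carrier) → x # 0# → Carrier
  x ⁻¹[ x#0 ] = proj₁ (#⇒invertible x#0)

  _/_[_] : (x y : Carrier) → y # 0# → Carrier
  x / y [ y#0 ] = x * y ⁻¹[ y#0 ]

  𝟏 : {p : Level} {P : Set p} → Dec P → Carrier
  𝟏 P? = if does P? then 1# else 0#

  -- (x;q)ₙ = (1 - x)(1 - xq) ⋯ (1 - xqⁿ⁻¹)
  poch : Carrier → ℕ → Carrier
  poch x zero    = 1#
  poch x (suc n) = poch x n * (1# - x * q ^ n)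

  -- For x = q this says that q is not a root of unity.
  Generic : Carrier → Set ℓ₂
  Generic x = ∀ n → poch x n # 0#

  -- W t s … i j k l is W^𝗌_{t,s}(i,j;k,l).  The truncated i ∸ l is harmless:
  -- the second indicator vanishes unless l ≤ i.
  W : (t s : Carrier) → t # 0# → Generic (s ^ 2) → Generic q →
      ℕ → ℕ → ℕ → ℕ → Carrier
  W t s t#0 s²-gen q-gen i j k l =
      𝟏 (i ℕ.+ j ≟ k ℕ.+ l) * 𝟏 (l ≤? i)
    * (s ^ (2 ℕ.* l) * t⁻¹ ^ (2 ℕ.* l))
    * (poch (s ^ 2 * t⁻¹ ^ 2) (i ∸ l) * poch (t ^ 2) l / poch (s ^ 2) i [ s²-gen i ])
    * (poch q i / poch q (i ∸ l) [ q-gen (i ∸ l) ] / poch q l [ q-gen l ])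
    where
    t⁻¹ : Carrier
    t⁻¹ = t ⁻¹[ t#0 ]

  -- w* u s … i l k j is w^{𝗌*}_{u;s}(i,l;k,j), with i the bottom, l the right,
  -- k the top and j the left label.
  w* : (u s : Carrier) → s # 0# → 1# - s * u # 0# →
       ℕ → Fin 2 → ℕ → Fin 2 → Carrier
  w* u s s#0 d i 0F k 0F =
    𝟏 (k ≟ i) * ((1# - s * u * q ^ i) / (1# - s * u) [ d ])
  w* u s s#0 d i 1F k 0F =
    𝟏 (k ≟ suc i) * (- (s ⁻¹[ s#0 ] * u) * (1# - s ^ 2 * q ^ i) / (1# - s * u) [ d ])
  w* u s s#0 d i 0F k 1F =
    𝟏 (suc k ≟ i) * ((1# - q ^ i) / (1# - s * u) [ d ])
  w* u s s#0 d i 1F k 1F =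
    𝟏 (k ≟ i) * ((q ^ i - s ⁻¹[ s#0 ] * u) / (1# - s * u) [ d ])

  -- The sum of f over l₁ ∈ {0,1} and l₂, l₃ ∈ ℕ has finite support and value v.
  -- The value is independent of the box N containing the support.
  SumsTo : (Fin 2 → ℕ → ℕ → Carrier) → Carrier → Set ℓ₁
  SumsTo f v = ∃[ N ]
      (∀ l₁ l₂ l₃ → N ≤ l₂ ⊎ N ≤ l₃ → f l₁ l₂ l₃ ≈ 0#)
    × (∑[ l₁ < 2 ] ∑[ l₂ < N ] ∑[ l₃ < N ] f l₁ (toℕ l₂) (toℕ l₃)) ≈ v

{-# OPTIONS --safe #-}
module Submission where

-- Put r = s²/t², T = t², z = x/s and h = η², so that s² = rT, y/t = zr, and the two sides
-- have the same denominators.  The weight factors as W(i,j;k,l) = Φ(i-l) Γ(l) Η(i), where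
-- Φ(n) = (r;q)ₙ/(q;q)ₙ, Γ(n) = rⁿ (T;q)ₙ/(q;q)ₙ and Η(n) = (q;q)ₙ/(s²;q)ₙ.
-- By conservation each l₁ contributes at most one term to either side.  The recurrence of Γ
-- absorbs one w* on the left and that of Η one w* on the right, so that Γ(b₂) Η(a₃) is common
-- to all four terms.  Those with l₁ = 0 then carry Φ(c+1) and those with l₁ = 1 carry Φ(c).
-- The differences of the two sides at l₁ = 0 and l₁ = 1 are
-- Φ(c+1)(1 - q^(c+1)) P and -Φ(c)(1 - r q^c) P for the same polynomial P, and the
-- recurrence of Φ makes them cancel.

open import Defs
open import Algebra.Apartness.Bundles using (HeytingField; HeytingCommutativeRing)
open import Algebra.Bundles using (CommutativeRing)
open import Data.Empty using (⊥; ⊥-elim)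
open import Data.Fin.Base using (Fin; toℕ; zero; suc)
open import Data.Fin.Patterns using (0F; 1F)
open import Data.Fin.Properties using (toℕ<n)
open import Data.Nat.Base as ℕ using (ℕ; zero; suc; _∸_; _≤_; _<_; s≤s; s<s⁻¹; s≤s⁻¹)
import Data.Nat.Properties as ℕ
open import Data.Nat.Properties using (_≟_; _≤?_)
open import Data.Product.Base using (∃-syntax; _×_; _,_; proj₂)
open import Data.Sum.Base using (_⊎_; inj₁; inj₂)
open import Level using (Level)
open import Relation.Binary.PropositionalEquality.Core as ≡ using (_≡_; _≢_)
open import Relation.Nullary.Decidable.Core using (Dec; yes; no; _×-dec_; dec⇒maybe)
open import Relation.Nullary.Negation using (¬_; contradiction)

-- The ring solver over an arbitrary commutative ring.

-- Equality of coefficients is not decidable in R itself, so the solver takes them in ℤ.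
module IntegerCoefficients {c ℓ : Level} (R : CommutativeRing c ℓ) where

  open CommutativeRing R
  open import Algebra.Properties.AbelianGroup +-abelianGroup
    using (ε⁻¹≈ε; ⁻¹-involutive; ⁻¹-∙-comm)
  open import Algebra.Properties.Ring ring using (-‿distribˡ-*; -‿distribʳ-*)
  open import Algebra.Properties.Semiring.Mult.TCOptimised semiring
    using (1+×; ×-homo-+; ×1-homo-*) renaming (_×_ to _·_)
  open import Algebra.Solver.Ring.AlmostCommutativeRing
    using (fromCommutativeRing; _-Raw-AlmostCommutative⟶_)
  open import Data.Integer.Base as ℤ using (ℤ; +_; -[1+_]; +[1+_]; _⊖_)
  import Data.Integer.Properties as ℤ
  open import Data.Maybe.Base as Maybe using ()
  open import Relation.Binary.Reasoning.Setoid setoid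

  -- The optimised multiple reduces `1 · 1#` to `1#`, so the solver's constant `con (+ 1)` denotes
  -- `1#` by computation.
  ⟦_⟧ : ℤ → Carrier
  ⟦ + n ⟧      = n · 1#
  ⟦ -[1+ n ] ⟧ = - (suc n · 1#)

  ⟦⟧-reflexive : ∀ {i j} → i ≡ j → ⟦ i ⟧ ≈ ⟦ j ⟧
  ⟦⟧-reflexive ≡.refl = refl

  ⟦⊖⟧ : ∀ m n → ⟦ m ⊖ n ⟧ ≈ m · 1# - n · 1#
  ⟦⊖⟧ zero    zero    = sym (-‿inverseʳ 0#)
  ⟦⊖⟧ zero    (suc n) = sym (+-identityˡ _)
  ⟦⊖⟧ (suc m) zero    = sym (trans (+-congˡ ε⁻¹≈ε) (+-identityʳ _))
  ⟦⊖⟧ (suc m) (suc n) = begin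
    ⟦ suc m ⊖ suc n ⟧                   ≈⟨ ⟦⟧-reflexive (ℤ.[1+m]⊖[1+n]≡m⊖n m n) ⟩
    ⟦ m ⊖ n ⟧                           ≈⟨ ⟦⊖⟧ m n ⟩
    m · 1# - n · 1#                     ≈⟨ +-congʳ (+-identityˡ _) ⟨
    -- The inserted `1# - 1#` provides the units that `1+×` joins to the multiples m and n.
    0# + m · 1# - n · 1#                ≈⟨ +-congʳ (+-congʳ (-‿inverseʳ 1#)) ⟨
    1# - 1# + m · 1# - n · 1#           ≈⟨ +-congʳ (trans (+-assoc _ _ _) (+-congˡ (+-comm _ _))) ⟩
    1# + (m · 1# - 1#) - n · 1#         ≈⟨ +-congʳ (+-assoc _ _ _) ⟨
    1# + m · 1# - 1# - n · 1#           ≈⟨ +-assoc _ _ _ ⟩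
    1# + m · 1# + (- 1# - n · 1#)       ≈⟨ +-congˡ (⁻¹-∙-comm _ _) ⟩
    1# + m · 1# - (1# + n · 1#)         ≈⟨ +-cong (1+× m 1#) (-‿cong (1+× n 1#)) ⟨
    suc m · 1# - suc n · 1#             ∎

  ⟦⟧-homo-+ : ∀ i j → ⟦ i ℤ.+ j ⟧ ≈ ⟦ i ⟧ + ⟦ j ⟧
  ⟦⟧-homo-+ (+ m)    (+ n)    = ×-homo-+ 1# m n
  ⟦⟧-homo-+ (+ m)    -[1+ n ] = ⟦⊖⟧ m (suc n)
  ⟦⟧-homo-+ -[1+ m ] (+ n)    = trans (⟦⊖⟧ n (suc m)) (+-comm _ _)
  ⟦⟧-homo-+ -[1+ m ] -[1+ n ] = begin
    ⟦ -[1+ m ] ℤ.+ -[1+ n ] ⟧     ≈⟨ ⟦⟧-reflexive (ℤ.neg-distrib-+ +[1+ m ] +[1+ n ]) ⟨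
    - ((suc m ℕ.+ suc n) · 1#)    ≈⟨ -‿cong (×-homo-+ 1# (suc m) (suc n)) ⟩
    - (suc m · 1# + suc n · 1#)   ≈⟨ ⁻¹-∙-comm _ _ ⟨
    - (suc m · 1#) - suc n · 1#   ∎

  ⟦⟧-homo-neg : ∀ i → ⟦ ℤ.- i ⟧ ≈ - ⟦ i ⟧
  ⟦⟧-homo-neg (+ zero) = sym ε⁻¹≈ε
  ⟦⟧-homo-neg +[1+ n ] = refl
  ⟦⟧-homo-neg -[1+ n ] = sym (⁻¹-involutive _)

  ⟦⟧-homo-*⁺ : ∀ m j → ⟦ + m ℤ.* j ⟧ ≈ ⟦ + m ⟧ * ⟦ j ⟧
  ⟦⟧-homo-*⁺ m (+ n)    = trans (⟦⟧-reflexive (≡.sym (ℤ.pos-* m n))) (×1-homo-* m n)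
  ⟦⟧-homo-*⁺ m -[1+ n ] = begin
    ⟦ + m ℤ.* -[1+ n ] ⟧          ≈⟨ ⟦⟧-reflexive (ℤ.neg-distribʳ-* (+ m) +[1+ n ]) ⟨
    ⟦ ℤ.- (+ m ℤ.* +[1+ n ]) ⟧    ≈⟨ ⟦⟧-homo-neg (+ m ℤ.* +[1+ n ]) ⟩
    - ⟦ + m ℤ.* +[1+ n ] ⟧        ≈⟨ -‿cong (⟦⟧-homo-*⁺ m +[1+ n ]) ⟩
    - (⟦ + m ⟧ * ⟦ +[1+ n ] ⟧)    ≈⟨ -‿distribʳ-* _ _ ⟩
    ⟦ + m ⟧ * ⟦ -[1+ n ] ⟧        ∎

  ⟦⟧-homo-* : ∀ i j → ⟦ i ℤ.* j ⟧ ≈ ⟦ i ⟧ * ⟦ j ⟧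
  ⟦⟧-homo-* (+ m)    j = ⟦⟧-homo-*⁺ m j
  ⟦⟧-homo-* -[1+ m ] j = begin
    ⟦ -[1+ m ] ℤ.* j ⟧         ≈⟨ ⟦⟧-reflexive (ℤ.neg-distribˡ-* +[1+ m ] j) ⟨
    ⟦ ℤ.- (+[1+ m ] ℤ.* j) ⟧   ≈⟨ ⟦⟧-homo-neg (+[1+ m ] ℤ.* j) ⟩
    - ⟦ +[1+ m ] ℤ.* j ⟧       ≈⟨ -‿cong (⟦⟧-homo-*⁺ (suc m) j) ⟩
    - (⟦ +[1+ m ] ⟧ * ⟦ j ⟧)   ≈⟨ -‿distribˡ-* _ _ ⟩
    ⟦ -[1+ m ] ⟧ * ⟦ j ⟧       ∎

  ⟦⟧-homomorphism : ℤ.+-*-rawRing -Raw-AlmostCommutative⟶ fromCommutativeRing R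
  ⟦⟧-homomorphism = record
    { ⟦_⟧    = ⟦_⟧
    ; +-homo = ⟦⟧-homo-+
    ; *-homo = ⟦⟧-homo-*
    ; -‿homo = ⟦⟧-homo-neg
    ; 0-homo = refl
    ; 1-homo = refl
    }

  open import Algebra.Solver.Ring ℤ.+-*-rawRing (fromCommutativeRing R) ⟦⟧-homomorphism
    (λ i j → Maybe.map ⟦⟧-reflexive (dec⇒maybe (i ℤ.≟ j))) public
    using (Polynomial; con; solve; _:=_; _:+_; _:*_; _:-_; :-_)

  :1 : ∀ {n} → Polynomial n
  :1 = con (+ 1)

-- Polynomial identities between products of two vertex numerators.

module ExchangeIdentities {c ℓ : Level} (R : CommutativeRing c ℓ) where

  open CommutativeRing R
  open import Relation.Binary.Reasoning.Setoid setoid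
  open IntegerCoefficients R public

  -- The numerator of w^{𝗌*}_{u;s}(i,l;k,j), in terms of z = u/s, A = s² and g = qⁱ.
  ν : (z A : Carrier) (j l : Fin 2) → Carrier → Carrier
  ν z A 0F 0F g = 1# - z * A * g
  ν z A 0F 1F g = - (z * (1# - A * g))
  ν z A 1F 0F g = 1# - g
  ν z A 1F 1F g = g - z

  -- α and β are what Γ-absorbs and Η-absorbs below leave of the absorbed factor ν.
  α : (z r T : Carrier) (l b : Fin 2) → Carrier → Carrier
  α z r T 0F 0F g = 1# - z * r * T * g
  α z r T 0F 1F g = - (z * (1# - g))
  α z r T 1F 0F g = r * (1# - T * g)
  α z r T 1F 1F g = g - z * r

  β : (z A : Carrier) (l b : Fin 2) → Carrier → Carrier
  β z A 0F 0F g = 1# - z * A * g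
  β z A 0F 1F g = - (z * (1# - g))
  β z A 1F 0F g = 1# - A * g
  β z A 1F 1F g = g - z

  ν-cong : ∀ {z A g g′} j l → g ≈ g′ → ν z A j l g ≈ ν z A j l g′
  ν-cong 0F 0F g≈g′ = +-congˡ (-‿cong (*-congˡ g≈g′))
  ν-cong 0F 1F g≈g′ = -‿cong (*-congˡ (+-congˡ (-‿cong (*-congˡ g≈g′))))
  ν-cong 1F 0F g≈g′ = +-congˡ (-‿cong g≈g′)
  ν-cong 1F 1F g≈g′ = +-congʳ g≈g′

  β-cong : ∀ {z A g g′} l b → g ≈ g′ → β z A l b g ≈ β z A l b g′
  β-cong 0F 0F g≈g′ = +-congˡ (-‿cong (*-congˡ g≈g′))
  β-cong 0F 1F g≈g′ = -‿cong (*-congˡ (+-congˡ (-‿cong g≈g′)))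
  β-cong 1F 0F g≈g′ = +-congˡ (-‿cong (*-congˡ g≈g′))
  β-cong 1F 1F g≈g′ = +-congʳ g≈g′

  -- The case of exponent 0, where the term with l₁ = 0 has no partner and must match alone. It is
  -- `cofactor₀` at D = 1, where the multiple of `cofactor` drops out.
  edge-identity : ∀ z r T h a b M E →
    α z r T 0F b M * ν z (h * (r * T)) a 0F E ≈ β z (r * T) 0F b M * ν (z * r) (h * T) a 0F E
  edge-identity z r T h 0F 0F M E = solve 6 (λ z r T h M E →
    (:1 :- z :* r :* T :* M) :* (:1 :- z :* (h :* (r :* T)) :* E) :=
    (:1 :- z :* (r :* T) :* M) :* (:1 :- z :* r :* (h :* T) :* E)) refl z r T h M E
  edge-identity z r T h 0F 1F M E = *-congˡ (solve 5 (λ z r T h E →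
    :1 :- z :* (h :* (r :* T)) :* E := :1 :- z :* r :* (h :* T) :* E) refl z r T h E)
  edge-identity z r T h 1F 0F M E = *-congʳ (solve 4 (λ z r T M →
    :1 :- z :* r :* T :* M := :1 :- z :* (r :* T) :* M) refl z r T M)
  edge-identity z r T h 1F 1F M E = refl

  -- The polynomial P of the overview, in M = q^b₂ and E = q^a₂. It involves neither C nor D, so
  -- both values of l₁ can share it.
  cofactor : (z A h : Carrier) (a b : Fin 2) (M E : Carrier) → Carrier
  cofactor z A h 0F 0F M E = z * A * (h * E - M)
  cofactor z A h 0F 1F M E = z * (M - h * z * A * E)
  cofactor z A h 1F 0F M E = E - z * A * M
  cofactor z A h 1F 1F M E = z * (M - E)

  -- Here D = q^(c+1) rescales the argument of `ν` on one side and of `β` on the other. The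
  -- difference of the two products is affine in D and vanishes at D = 1, hence is 1 - D times a
  -- polynomial free of D.
  cofactor₀ : ∀ z r T h a b M E D →
    α z r T 0F b M * ν z (h * (r * T)) a 0F (E * D) ≈
    β z (r * T) 0F b (M * D) * ν (z * r) (h * T) a 0F E
      + (1# - D) * cofactor z (r * T) h a b M E
  cofactor₀ z r T h 0F 0F M E D = solve 7 (λ z r T h M E D →
    (:1 :- z :* r :* T :* M) :* (:1 :- z :* (h :* (r :* T)) :* (E :* D)) :=
    (:1 :- z :* (r :* T) :* (M :* D)) :* (:1 :- z :* r :* (h :* T) :* E)
      :+ (:1 :- D) :* (z :* (r :* T) :* (h :* E :- M))) refl z r T h M E D
  cofactor₀ z r T h 0F 1F M E D = solve 7 (λ z r T h M E D →
    (:- (z :* (:1 :- M))) :* (:1 :- z :* (h :* (r :* T)) :* (E :* D)) :=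
    (:- (z :* (:1 :- M :* D))) :* (:1 :- z :* r :* (h :* T) :* E)
      :+ (:1 :- D) :* (z :* (M :- h :* z :* (r :* T) :* E))) refl z r T h M E D
  cofactor₀ z r T h 1F 0F M E D = solve 6 (λ z r T M E D →
    (:1 :- z :* r :* T :* M) :* (:1 :- E :* D) :=
    (:1 :- z :* (r :* T) :* (M :* D)) :* (:1 :- E)
      :+ (:1 :- D) :* (E :- z :* (r :* T) :* M)) refl z r T M E D
  cofactor₀ z r T h 1F 1F M E D = solve 4 (λ z M E D →
    (:- (z :* (:1 :- M))) :* (:1 :- E :* D) :=
    (:- (z :* (:1 :- M :* D))) :* (:1 :- E)
      :+ (:1 :- D) :* (z :* (M :- E))) refl z M E D

  -- With C = q^c the difference is affine in C and vanishes where rC = 1. The remaining factor is,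
  -- up to sign, the one found for l₁ = 0.
  cofactor₁ : ∀ z r T h a b M E C →
    α z r T 1F b M * ν z (h * (r * T)) a 1F (E * C)
      + (1# - r * C) * cofactor z (r * T) h a b M E ≈
    β z (r * T) 1F b (M * C) * ν (z * r) (h * T) a 1F E
  cofactor₁ z r T h 0F 0F M E C = solve 7 (λ z r T h M E C →
    r :* (:1 :- T :* M) :* (:- (z :* (:1 :- h :* (r :* T) :* (E :* C))))
      :+ (:1 :- r :* C) :* (z :* (r :* T) :* (h :* E :- M)) :=
    (:1 :- r :* T :* (M :* C)) :* (:- (z :* r :* (:1 :- h :* T :* E)))) refl z r T h M E C
  cofactor₁ z r T h 0F 1F M E C = solve 7 (λ z r T h M E C →
    (M :- z :* r) :* (:- (z :* (:1 :- h :* (r :* T) :* (E :* C))))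
      :+ (:1 :- r :* C) :* (z :* (M :- h :* z :* (r :* T) :* E)) :=
    (M :* C :- z) :* (:- (z :* r :* (:1 :- h :* T :* E)))) refl z r T h M E C
  cofactor₁ z r T h 1F 0F M E C = solve 6 (λ z r T M E C →
    r :* (:1 :- T :* M) :* (E :* C :- z) :+ (:1 :- r :* C) :* (E :- z :* (r :* T) :* M) :=
    (:1 :- r :* T :* (M :* C)) :* (E :- z :* r)) refl z r T M E C
  cofactor₁ z r T h 1F 1F M E C = solve 5 (λ z r M E C →
    (M :- z :* r) :* (E :* C :- z) :+ (:1 :- r :* C) :* (z :* (M :- E)) :=
    (M :* C :- z) :* (E :- z :* r)) refl z r M E C

  -- The hypothesis is the recurrence of Φ, with X = Φ(c) and Y = Φ(c+1). It turns the excess Y(1 -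
  -- D)P at l₁ = 0 into X(1 - rC)P, exactly what is missing at l₁ = 1.
  exchange : ∀ z r T h a b M E C D X Y → Y * (1# - D) ≈ X * (1# - r * C) →
    Y * (α z r T 0F b M * ν z (h * (r * T)) a 0F (E * D))
      + X * (α z r T 1F b M * ν z (h * (r * T)) a 1F (E * C)) ≈
    Y * (β z (r * T) 0F b (M * D) * ν (z * r) (h * T) a 0F E)
      + X * (β z (r * T) 1F b (M * C) * ν (z * r) (h * T) a 1F E)
  exchange z r T h a b M E C D X Y Y[1-D]≈X[1-rC] = begin
    Y * L₀ + X * L₁                          ≈⟨ +-congʳ (*-congˡ (cofactor₀ z r T h a b M E D)) ⟩
    Y * (R₀ + (1# - D) * P) + X * L₁         ≈⟨ +-congʳ (distribˡ _ _ _) ⟩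
    Y * R₀ + Y * ((1# - D) * P) + X * L₁     ≈⟨ +-congʳ (+-congˡ (*-assoc _ _ _)) ⟨
    Y * R₀ + Y * (1# - D) * P + X * L₁       ≈⟨ +-congʳ (+-congˡ (*-congʳ Y[1-D]≈X[1-rC])) ⟩
    Y * R₀ + X * (1# - r * C) * P + X * L₁   ≈⟨ solve 5 (λ YR X u P L₁ →
      YR :+ X :* u :* P :+ X :* L₁ := YR :+ X :* (L₁ :+ u :* P)) refl (Y * R₀) X (1# - r * C) P L₁ ⟩
    Y * R₀ + X * (L₁ + (1# - r * C) * P)     ≈⟨ +-congˡ (*-congˡ (cofactor₁ z r T h a b M E C)) ⟩
    Y * R₀ + X * R₁                          ∎
    where
    P L₀ L₁ R₀ R₁ : Carrier
    P  = cofactor z (r * T) h a b M E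
    L₀ = α z r T 0F b M * ν z (h * (r * T)) a 0F (E * D)
    L₁ = α z r T 1F b M * ν z (h * (r * T)) a 1F (E * C)
    R₀ = β z (r * T) 0F b (M * D) * ν (z * r) (h * T) a 0F E
    R₁ = β z (r * T) 1F b (M * C) * ν (z * r) (h * T) a 1F E

-- Conservation laws and admissible exponents.

-- A nonzero term with l₁ = l has weight factor Φ(e) for the unique admissible e;
-- here M = a₁ + b₃, N = b₁ + a₃, m = a₂ and n = b₂.
record Admissible (M N m n l e : ℕ) : Set where
  constructor admissible
  field
    M≡ : M ≡ l ℕ.+ (m ℕ.+ e)
    N≡ : N ≡ l ℕ.+ (n ℕ.+ e)

admissible-unique : ∀ {M N m n} l {e e′} →
  Admissible M N m n l e → Admissible M N m n l e′ → e ≡ e′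
admissible-unique {m = m} l (admissible M≡ _) (admissible M≡′ _) =
  ℕ.+-cancelˡ-≡ m _ _ (ℕ.+-cancelˡ-≡ l _ _ (≡.trans (≡.sym M≡) M≡′))

-- Raising l₁ from 0 to 1 costs one unit of the exponent. This pairs Φ(c+1) at l₁ = 0 with Φ(c) at
-- l₁ = 1.
admissible-suc : ∀ {M N m n e} → Admissible M N m n 1 e → Admissible M N m n 0 (suc e)
admissible-suc {m = m} {n} {e} (admissible M≡ N≡) =
  admissible (≡.trans M≡ (≡.sym (ℕ.+-suc m e))) (≡.trans N≡ (≡.sym (ℕ.+-suc n e)))

admissible-pred : ∀ {M N m n e} → Admissible M N m n 0 (suc e) → Admissible M N m n 1 e
admissible-pred {m = m} {n} {e} (admissible M≡ N≡) =
  admissible (≡.trans M≡ (ℕ.+-suc m e)) (≡.trans N≡ (ℕ.+-suc n e))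

-- Deciding l₁ = 0 settles l₁ = 1 as well, by `admissible-suc` and `admissible-pred`. The only
-- candidate for the exponent is N - n.
admissible? : ∀ M N m n → Dec (∃[ e ] Admissible M N m n 0 e)
admissible? M N m n with n ≤? N | M ≟ m ℕ.+ (N ∸ n)
... | yes n≤N | yes M≡ = yes (N ∸ n , admissible M≡ (≡.sym (ℕ.m+[n∸m]≡n n≤N)))
... | no n≰N  | _      = no λ { (e , admissible _ ≡.refl) → n≰N (ℕ.m≤m+n n e) }
... | yes _   | no M≢  = no λ { (e , admissible M≡ ≡.refl) →
  M≢ (≡.trans M≡ (≡.cong (m ℕ.+_) (≡.sym (ℕ.m+n∸m≡n n e)))) }

+-transfer : ∀ l b {m m′} e → l ℕ.+ m ≡ b ℕ.+ m′ → b ℕ.+ (m′ ℕ.+ e) ≡ l ℕ.+ (m ℕ.+ e)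
+-transfer l b {m} {m′} e l+m≡b+m′ = ≡.trans (≡.sym (ℕ.+-assoc b m′ e))
  (≡.trans (≡.cong (ℕ._+ e) (≡.sym l+m≡b+m′)) (ℕ.+-assoc l m e))

+-transfer⁻¹ : ∀ l b {m m′ e n} → l ℕ.+ m ≡ b ℕ.+ m′ → b ℕ.+ n ≡ l ℕ.+ (m ℕ.+ e) → n ≡ m′ ℕ.+ e
+-transfer⁻¹ l b {e = e} l+m≡b+m′ b+n≡ =
  ℕ.+-cancelˡ-≡ b _ _ (≡.trans b+n≡ (≡.sym (+-transfer l b e l+m≡b+m′)))

m≡b+n⇒n≡m∸b : ∀ {m n} b → m ≡ b ℕ.+ n → n ≡ m ∸ b
m≡b+n⇒n≡m∸b {n = n} b m≡b+n = ≡.trans (≡.sym (ℕ.m+n∸m≡n b n)) (≡.cong (_∸ b) (≡.sym m≡b+n))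

+-rearrange : ∀ k e m → k ℕ.+ e ℕ.+ m ≡ m ℕ.+ e ℕ.+ k
+-rearrange k e m = ≡.trans (ℕ.+-comm (k ℕ.+ e) m)
  (≡.trans (≡.cong (m ℕ.+_) (ℕ.+-comm k e)) (≡.sym (ℕ.+-assoc m e k)))

-- The four hypotheses are what a nonzero term requires: conservation and the inequality for `W`,
-- and conservation at each dual vertex. Eliminating l₂ and l₃ leaves the two equations of
-- `Admissible`.
lhs-admissible : ∀ l b {M n a m l₂ l₃} →
  n ℕ.+ a ≡ l₃ ℕ.+ l₂ → l₂ ≤ n → M ≡ l ℕ.+ l₃ → l ℕ.+ m ≡ b ℕ.+ l₂ →
  ∃[ e ] Admissible M (b ℕ.+ n) a m l e × l₂ ≡ l ℕ.+ m ∸ b × l₃ ≡ a ℕ.+ e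
lhs-admissible l b {a = a} {l₂ = l₂} {l₃} n+a≡ l₂≤n ≡.refl l+m≡
  -- The exponent is the argument i - l of Φ in `W`, here a₃ - l₂.
  with e , ≡.refl ← ℕ.m≤n⇒∃[o]m+o≡n l₂≤n =
  e , admissible (≡.cong (l ℕ.+_) l₃≡) (+-transfer l b e l+m≡) , m≡b+n⇒n≡m∸b b l+m≡ , l₃≡
  where
  l₃≡ : l₃ ≡ a ℕ.+ e
  l₃≡ = ℕ.+-cancelʳ-≡ l₂ _ _ (≡.trans (≡.sym n+a≡) (+-rearrange l₂ e a))

rhs-admissible : ∀ l a {N k m n l₂ l₃} →
  l₃ ℕ.+ l₂ ≡ k ℕ.+ n → n ≤ l₃ → a ℕ.+ l₂ ≡ l ℕ.+ m → l ℕ.+ l₃ ≡ N →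
  ∃[ e ] Admissible (a ℕ.+ k) N m n l e × l₂ ≡ l ℕ.+ m ∸ a × l₃ ≡ n ℕ.+ e
rhs-admissible l a {k = k} {m} {n} {l₂} l₃+l₂≡ n≤l₃ a+l₂≡ ≡.refl
  -- On this side i - l is l₃ - b₂.
  with e , ≡.refl ← ℕ.m≤n⇒∃[o]m+o≡n n≤l₃ =
  e , admissible (≡.trans (≡.cong (a ℕ.+_) k≡) (+-transfer l a e (≡.sym a+l₂≡))) ≡.refl ,
  m≡b+n⇒n≡m∸b a (≡.sym a+l₂≡) , ≡.refl
  where
  k≡ : k ≡ l₂ ℕ.+ e
  k≡ = ℕ.+-cancelʳ-≡ n _ _ (≡.trans (≡.sym l₃+l₂≡) (+-rearrange n e l₂))

-- Inverses, finite sums and ratios of q-Pochhammer symbols.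

module VertexWeights {c ℓ₁ ℓ₂ : Level} (F : HeytingField c ℓ₁ ℓ₂)
                     (q : HeytingField.Carrier F) where

  open HeytingField F
  open Weights F q
  private
    R : CommutativeRing c ℓ₁
    R = HeytingCommutativeRing.commutativeRing heytingCommutativeRing
  open CommutativeRing R
    using (semiring; commutativeSemiring)
  open import Algebra.Properties.AbelianGroup (CommutativeRing.+-abelianGroup R)
    using (ε⁻¹≈ε)
  open import Algebra.Properties.CommutativeSemiring.Exp commutativeSemiring
    using (^-assocʳ; ^-distrib-*)
  open import Algebra.Properties.Semiring.Exp semiring using (^-homo-*)
  open import Algebra.Properties.Semiring.Sum semiring using (sum; sum-cong-≋; sum-replicate-zero)
  open import Relation.Binary.Reasoning.Setoid setoid
  open ExchangeIdentities R

  x-0≈x : ∀ x → x - 0# ≈ x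
  x-0≈x x = trans (+-congˡ ε⁻¹≈ε) (+-identityʳ x)

  ⁻¹-inverseʳ : ∀ {x} (x#0 : x # 0#) → x * x ⁻¹[ x#0 ] ≈ 1#
  ⁻¹-inverseʳ {x} x#0 = trans (*-congʳ (sym (x-0≈x x))) (proj₂ (proj₂ (#⇒invertible x#0)))

  -- The inverse `_⁻¹[_]` takes a witness of apartness besides the element. Uniqueness removes this
  -- dependence and identifies inverses that arise in different ways.
  inverse-unique : ∀ {x y i j} → x ≈ y → x * i ≈ 1# → y * j ≈ 1# → i ≈ j
  inverse-unique {x} {y} {i} {j} x≈y xi≈1 yj≈1 = begin
    i            ≈⟨ *-identityʳ i ⟨
    i * 1#       ≈⟨ *-congˡ yj≈1 ⟨
    i * (y * j)  ≈⟨ *-congˡ (*-congʳ x≈y) ⟨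
    i * (x * j)  ≈⟨ solve 3 (λ i x j → i :* (x :* j) := x :* i :* j) refl i x j ⟩
    x * i * j    ≈⟨ *-congʳ xi≈1 ⟩
    1# * j       ≈⟨ *-identityˡ j ⟩
    j            ∎

  ⁻¹-cong : ∀ {x y} (x#0 : x # 0#) (y#0 : y # 0#) → x ≈ y → x ⁻¹[ x#0 ] ≈ y ⁻¹[ y#0 ]
  ⁻¹-cong x#0 y#0 x≈y = inverse-unique x≈y (⁻¹-inverseʳ x#0) (⁻¹-inverseʳ y#0)

  𝟏-true : ∀ {p} {P : Set p} (P? : Dec P) → P → 𝟏 P? ≈ 1#
  𝟏-true (yes _) _ = refl
  𝟏-true (no ¬P) P = contradiction P ¬P

  𝟏-false : ∀ {p} {P : Set p} (P? : Dec P) → ¬ P → 𝟏 P? ≈ 0#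
  𝟏-false (yes P) ¬P = contradiction P ¬P
  𝟏-false (no _)  _  = refl

  0-*ˡ : ∀ {x} y → x ≈ 0# → x * y ≈ 0#
  0-*ˡ y x≈0 = trans (*-congʳ x≈0) (zeroˡ y)

  0-*ʳ : ∀ x {y} → y ≈ 0# → x * y ≈ 0#
  0-*ʳ x y≈0 = trans (*-congˡ y≈0) (zeroʳ x)

  *-neg-* : ∀ x y w → x * - (y * w) ≈ - (y * (x * w))
  *-neg-* = solve 3 (λ x y w → x :* (:- (y :* w)) := :- (y :* (x :* w))) refl

  1-*ˡ : ∀ {x} y → x ≈ 1# → x * y ≈ y
  1-*ˡ y x≈1 = trans (*-congʳ x≈1) (*-identityˡ y)

  sum-zero : ∀ {n} (f : Fin n → Carrier) → (∀ i → f i ≈ 0#) → sum f ≈ 0#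
  sum-zero {n} f f≈0 = trans (sum-cong-≋ {n} {f} {λ _ → 0#} f≈0) (sum-replicate-zero n)

  sum-point : ∀ n (f : ℕ → Carrier) p → p < n → (∀ i → i ≢ p → f i ≈ 0#) →
              ∑[ i < n ] f (toℕ i) ≈ f p
  sum-point (suc n) f zero    p<n f≈0 =
    trans (+-congˡ (sum-zero {n} _ (λ i → f≈0 (suc (toℕ i)) λ ()))) (+-identityʳ _)
  sum-point (suc n) f (suc p) p<n f≈0 = trans (+-congʳ (f≈0 0 λ ())) (trans (+-identityˡ _)
    (sum-point n (λ i → f (suc i)) p (s<s⁻¹ p<n)
      (λ i i≢p → f≈0 (suc i) (λ e → i≢p (ℕ.suc-injective e)))))

  sum-point₂ : ∀ n (f : ℕ → ℕ → Carrier) p p′ → p < n → p′ < n →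
               (∀ i j → i ≢ p ⊎ j ≢ p′ → f i j ≈ 0#) →
               ∑[ i < n ] ∑[ j < n ] f (toℕ i) (toℕ j) ≈ f p p′
  sum-point₂ n f p p′ p<n p′<n f≈0 = trans
    (sum-point n (λ i → ∑[ j < n ] f i (toℕ j)) p p<n
      (λ i i≢p → sum-zero {n} _ (λ j → f≈0 i (toℕ j) (inj₁ i≢p))))
    (sum-point n (f p) p′ p′<n (λ j j≢p′ → f≈0 p j (inj₂ j≢p′)))

  ratio : (x y : Carrier) → Generic y → ℕ → Carrier
  ratio x y y-gen n = poch x n / poch y n [ y-gen n ]

  -- The recurrences of Φ, Γ and Η are all drawn from this one.
  ratio-suc : ∀ x y (y-gen : Generic y) n →
    ratio x y y-gen (suc n) * (1# - y * q ^ n) ≈ ratio x y y-gen n * (1# - x * q ^ n)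
  ratio-suc x y y-gen n = begin
    X * a * i′ * b      ≈⟨ solve 4 (λ X a i′ b → X :* a :* i′ :* b := X :* (b :* i′) :* a) refl X a i′ b ⟩
    -- Since (y;q)ₙ₊₁ = (y;q)ₙ b, the product `b * i′` is an inverse of (y;q)ₙ and so equals `i`.
    X * (b * i′) * a    ≈⟨ *-congʳ (*-congˡ (inverse-unique refl
                             (trans (sym (*-assoc _ _ _)) (⁻¹-inverseʳ (y-gen (suc n))))
                             (⁻¹-inverseʳ (y-gen n)))) ⟩
    X * i * a           ∎
    where
    X a b i i′ : Carrier
    X = poch x n
    a = 1# - x * q ^ n
    b = 1# - y * q ^ n
    i = poch y n ⁻¹[ y-gen n ]
    i′ = poch y (suc n) ⁻¹[ y-gen (suc n) ]

  -- Supports and normal forms of the two kinds of weight.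

  -- The indicator in each of the four clauses is the same conservation law: left plus top equals
  -- right plus bottom.
  w*-zero : ∀ u s s#0 d i l k j → toℕ j ℕ.+ k ≢ toℕ l ℕ.+ i → w* u s s#0 d i l k j ≈ 0#
  w*-zero u s s#0 d i 0F k 0F k≢i = 0-*ˡ _ (𝟏-false (k ≟ i) k≢i)
  w*-zero u s s#0 d i 1F k 0F k≢i = 0-*ˡ _ (𝟏-false (k ≟ suc i) k≢i)
  w*-zero u s s#0 d i 0F k 1F k≢i = 0-*ˡ _ (𝟏-false (suc k ≟ i) k≢i)
  w*-zero u s s#0 d i 1F k 1F k≢i = 0-*ˡ _ (𝟏-false (k ≟ i) (λ e → k≢i (≡.cong suc e)))

  -- The numerators depend on u and s only through u/s and s², as su = (u/s)s². Scaling both u and s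
  -- by η therefore changes only A.
  w*-ν : ∀ u s s#0 d i l k j {z A} → s ⁻¹[ s#0 ] * u ≈ z → s ^ 2 ≈ A → toℕ j ℕ.+ k ≡ toℕ l ℕ.+ i →
    w* u s s#0 d i l k j ≈ ν z A j l (q ^ i) * (1# - s * u) ⁻¹[ d ]
  w*-ν u s s#0 d i 0F k 0F {z} {A} u/s≈z s²≈A k≡i =
    trans (1-*ˡ _ (𝟏-true (k ≟ i) k≡i)) (*-congʳ (+-congˡ (-‿cong (*-congʳ su≈zA))))
    where
    su≈zA : s * u ≈ z * A
    su≈zA = begin
      s * u                                 ≈⟨ 1-*ˡ _ (⁻¹-inverseʳ s#0) ⟨
      s * s ⁻¹[ s#0 ] * (s * u)             ≈⟨ solve 3 (λ s i u →
                                                 s :* i :* (s :* u) := i :* u :* (s :* (s :* :1)))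
                                                 refl s (s ⁻¹[ s#0 ]) u ⟩
      s ⁻¹[ s#0 ] * u * s ^ 2               ≈⟨ *-cong u/s≈z s²≈A ⟩
      z * A                                 ∎
  w*-ν u s s#0 d i 1F k 0F u/s≈z s²≈A k≡i = trans (1-*ˡ _ (𝟏-true (k ≟ suc i) k≡i))
    (*-congʳ (trans (solve 2 (λ a b → (:- a) :* b := :- (a :* b)) refl _ _)
                    (-‿cong (*-cong u/s≈z (+-congˡ (-‿cong (*-congʳ s²≈A)))))))
  w*-ν u s s#0 d i 0F k 1F u/s≈z s²≈A k≡i = 1-*ˡ _ (𝟏-true (suc k ≟ i) k≡i)
  w*-ν u s s#0 d i 1F k 1F u/s≈z s²≈A k≡i =
    trans (1-*ˡ _ (𝟏-true (k ≟ i) (ℕ.suc-injective k≡i))) (*-congʳ (+-congˡ (-‿cong u/s≈z)))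

  module _ (t s : Carrier) (t#0 : t # 0#) (s²-gen : Generic (s ^ 2)) (q-gen : Generic q) where

    private
      t⁻¹ r T : Carrier
      t⁻¹ = t ⁻¹[ t#0 ]
      r = s ^ 2 * t⁻¹ ^ 2
      T = t ^ 2

    W-zero : ∀ i j k l → ¬ (i ℕ.+ j ≡ k ℕ.+ l × l ≤ i) → W t s t#0 s²-gen q-gen i j k l ≈ 0#
    W-zero i j k l ¬p = 0-*ˡ _ (0-*ˡ _ (0-*ˡ _ (lemma (i ℕ.+ j ≟ k ℕ.+ l) (l ≤? i) ¬p)))
      where
      lemma : ∀ {P Q : Set} (P? : Dec P) (Q? : Dec Q) → ¬ (P × Q) → 𝟏 P? * 𝟏 Q? ≈ 0#
      lemma (yes P) Q? ¬pq = 0-*ʳ _ (𝟏-false Q? (λ Q → ¬pq (P , Q)))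
      lemma (no _)  Q? ¬pq = zeroˡ _

    W-factor : ∀ i j k l → i ℕ.+ j ≡ k ℕ.+ l → l ≤ i →
      W t s t#0 s²-gen q-gen i j k l ≈
      ratio r q q-gen (i ∸ l) * (r ^ l * ratio T q q-gen l) * ratio q (s ^ 2) s²-gen i
    W-factor i j k l e l≤i = begin
      𝟏 (i ℕ.+ j ≟ k ℕ.+ l) * 𝟏 (l ≤? i) * ρ * (a * b * c′) * (d * e′ * f)
        ≈⟨ *-congʳ (*-congʳ (*-cong
             (trans (1-*ˡ _ (𝟏-true (i ℕ.+ j ≟ k ℕ.+ l) e)) (𝟏-true (l ≤? i) l≤i)) ρ≈r^l)) ⟩
      1# * r ^ l * (a * b * c′) * (d * e′ * f)
        ≈⟨ solve 7 (λ ρ a b c d e f → :1 :* ρ :* (a :* b :* c) :* (d :* e :* f) :=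
             a :* e :* (ρ :* (b :* f)) :* (d :* c)) refl (r ^ l) a b c′ d e′ f ⟩
      a * e′ * (r ^ l * (b * f)) * (d * c′) ∎
      where
      ρ a b c′ d e′ f : Carrier
      ρ = s ^ (2 ℕ.* l) * t⁻¹ ^ (2 ℕ.* l)
      a = poch r (i ∸ l)
      b = poch T l
      c′ = poch (s ^ 2) i ⁻¹[ s²-gen i ]
      d = poch q i
      e′ = poch q (i ∸ l) ⁻¹[ q-gen (i ∸ l) ]
      f = poch q l ⁻¹[ q-gen l ]
      ρ≈r^l : ρ ≈ r ^ l
      ρ≈r^l = sym (trans (^-distrib-* (s ^ 2) (t⁻¹ ^ 2) l) (*-cong (^-assocʳ s 2 l) (^-assocʳ t⁻¹ 2 l)))

  -- Sums with at most one nonzero term for each l₁.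

  -- Decidability of the three conditions, which concern labels only, picks out a vanishing factor;
  -- nothing is decided in the field.
  product-zero : ∀ {P Q S : Set} {x y z : Carrier} → Dec P → Dec Q → Dec S →
    (¬ P → x ≈ 0#) → (¬ Q → y ≈ 0#) → (¬ S → z ≈ 0#) → (P → Q → S → ⊥) → x * y * z ≈ 0#
  product-zero (no ¬P) _       _       x≈0 y≈0 z≈0 _   = 0-*ˡ _ (0-*ˡ _ (x≈0 ¬P))
  product-zero (yes _) (no ¬Q) _       x≈0 y≈0 z≈0 _   = 0-*ˡ _ (0-*ʳ _ (y≈0 ¬Q))
  product-zero (yes _) (yes _) (no ¬S) x≈0 y≈0 z≈0 _   = 0-*ʳ _ (z≈0 ¬S)
  product-zero (yes P) (yes Q) (yes S) x≈0 y≈0 z≈0 ¬PQS = ⊥-elim (¬PQS P Q S)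

  SumsTo-≈ : ∀ {f v v′} → v ≈ v′ → SumsTo f v → SumsTo f v′
  SumsTo-≈ v≈v′ (n , f≈0 , ∑≈v) = n , f≈0 , trans ∑≈v v≈v′

  -- Both sides of the equation are instances: l₂ sits at `p l`, l₃ at `o + e`, and `B` bounds the
  -- box. The refutation in `support` covers at once the points away from that place and the l
  -- without an exponent.
  module OnePointSummands (f : Fin 2 → ℕ → ℕ → Carrier) (v : Fin 2 → ℕ → Carrier)
           (M N m n : ℕ) (p : Fin 2 → ℕ) (o B : ℕ)
           (p<B : ∀ (l : Fin 2) → p l < B)
           (o<B : ∀ (l : Fin 2) e → Admissible M N m n (toℕ l) e → o ℕ.+ e < B)
           (support : ∀ (l : Fin 2) l₂ l₃ →
              (∀ e → Admissible M N m n (toℕ l) e → l₂ ≡ p l → l₃ ≡ o ℕ.+ e → ⊥) → f l l₂ l₃ ≈ 0#)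
           (value : ∀ (l : Fin 2) e → Admissible M N m n (toℕ l) e → f l (p l) (o ℕ.+ e) ≈ v l e)
           where

    private
      Adm : Fin 2 → ℕ → Set
      Adm l = Admissible M N m n (toℕ l)

    vanishes-outside : ∀ l l₂ l₃ → B ≤ l₂ ⊎ B ≤ l₃ → f l l₂ l₃ ≈ 0#
    vanishes-outside l l₂ l₃ (inj₁ B≤l₂) = support l l₂ l₃
      λ { e adm ≡.refl _ → ℕ.<⇒≱ (p<B l) B≤l₂ }
    vanishes-outside l l₂ l₃ (inj₂ B≤l₃) = support l l₂ l₃
      λ { e adm _ ≡.refl → ℕ.<⇒≱ (o<B l e adm) B≤l₃ }

    box-sum : ∀ l e → Adm l e → ∑[ i < B ] ∑[ j < B ] f l (toℕ i) (toℕ j) ≈ v l e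
    box-sum l e adm = trans
      (sum-point₂ B (f l) (p l) (o ℕ.+ e) (p<B l) (o<B l e adm) λ i j off → support l i j (excluded off))
      (value l e adm)
      where
      excluded : ∀ {i j} → i ≢ p l ⊎ j ≢ o ℕ.+ e → ∀ e′ → Adm l e′ → i ≡ p l → j ≡ o ℕ.+ e′ → ⊥
      excluded (inj₁ i≢p) e′ adm′ i≡p _ = i≢p i≡p
      excluded (inj₂ j≢o) e′ adm′ _ j≡o =
        j≢o (≡.trans j≡o (≡.cong (o ℕ.+_) (admissible-unique (toℕ l) adm′ adm)))

    box-sum-empty : ∀ l → (∀ e → ¬ Adm l e) → ∑[ i < B ] ∑[ j < B ] f l (toℕ i) (toℕ j) ≈ 0#
    box-sum-empty l none = sum-zero {B} _ λ i → sum-zero {B} _ λ j →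
      support l (toℕ i) (toℕ j) λ e adm _ _ → none e adm

    sumsTo-both : ∀ c → Adm 0F (suc c) → SumsTo f (v 0F (suc c) + v 1F c)
    sumsTo-both c adm = B , vanishes-outside ,
      +-cong (box-sum 0F (suc c) adm) (trans (+-identityʳ _) (box-sum 1F c (admissible-pred adm)))

    sumsTo-single : Adm 0F 0 → SumsTo f (v 0F 0)
    sumsTo-single adm = B , vanishes-outside , trans
      (+-cong (box-sum 0F 0 adm) (trans (+-identityʳ _) (box-sum-empty 1F none)))
      (+-identityʳ _)
      where
      none : ∀ e → ¬ Adm 1F e
      -- An exponent e at l₁ = 1 would give e + 1 at l₁ = 0, where 0 is the only one.
      none e adm′ with () ← admissible-unique 0 (admissible-suc adm′) adm

    sumsTo-none : (∀ e → ¬ Adm 0F e) → SumsTo f 0#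
    sumsTo-none none = B , vanishes-outside , trans
      (+-cong (box-sum-empty 0F none)
              (trans (+-identityʳ _) (box-sum-empty 1F λ e adm → none (suc e) (admissible-suc adm))))
      (+-identityʳ _)

  -- The two sides for fixed parameters and boundary labels.

  module _
    (η x y s t : Carrier) (xs≈yt : x * s ≈ y * t)
    (q-gen : Generic q) (s²-gen : Generic (s ^ 2))
    (s#0 : s # 0#) (t#0 : t # 0#) (ηs#0 : η * s # 0#) (ηt#0 : η * t # 0#)
    (sx#1 : 1# - s * x # 0#) (ty#1 : 1# - t * y # 0#)
    (ηsηx#1 : 1# - (η * s) * (η * x) # 0#) (ηtηy#1 : 1# - (η * t) * (η * y) # 0#)
    (a₁ b₁ : Fin 2) (a₂ a₃ b₂ b₃ : ℕ)
    where

    lhs rhs : Fin 2 → ℕ → ℕ → Carrier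
    lhs l₁ l₂ l₃ = W t s t#0 s²-gen q-gen a₃ a₂ l₃ l₂
                 * w* (η * x) (η * s) ηs#0 ηsηx#1 l₃ l₁ b₃ a₁
                 * w* y t t#0 ty#1 l₂ b₁ b₂ l₁
    rhs l₁ l₂ l₃ = w* (η * y) (η * t) ηt#0 ηtηy#1 a₂ l₁ l₂ a₁
                 * w* x s s#0 sx#1 a₃ b₁ l₃ l₁
                 * W t s t#0 s²-gen q-gen l₃ l₂ b₃ b₂

    private
      s⁻¹ t⁻¹ z r T h : Carrier
      s⁻¹ = s ⁻¹[ s#0 ]
      t⁻¹ = t ⁻¹[ t#0 ]
      z = s⁻¹ * x
      r = s ^ 2 * t⁻¹ ^ 2
      T = t ^ 2
      h = η ^ 2

      Φ Γ Η : ℕ → Carrier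
      Φ = ratio r q q-gen
      Γ m = r ^ m * ratio T q q-gen m
      Η = ratio q (s ^ 2) s²-gen

      ss⁻¹≈1 : s * s⁻¹ ≈ 1#
      ss⁻¹≈1 = ⁻¹-inverseʳ s#0

      tt⁻¹≈1 : t * t⁻¹ ≈ 1#
      tt⁻¹≈1 = ⁻¹-inverseʳ t#0

      s²≈rT : s ^ 2 ≈ r * T
      s²≈rT = begin
        s ^ 2                                  ≈⟨ 1-*ˡ _ (trans (*-cong tt⁻¹≈1 tt⁻¹≈1) (*-identityˡ 1#)) ⟨
        t * t⁻¹ * (t * t⁻¹) * s ^ 2            ≈⟨ solve 3 (λ t i S → t :* i :* (t :* i) :* S :=
                                                    S :* (i :* (i :* :1)) :* (t :* (t :* :1))) refl t t⁻¹ (s ^ 2) ⟩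
        r * T                                  ∎

      -- By the relation, y/t = yt/t² = xs/t² = (x/s)(s²/t²).
      t⁻¹y≈zr : t⁻¹ * y ≈ z * r
      t⁻¹y≈zr = begin
        t⁻¹ * y                            ≈⟨ 1-*ˡ _ tt⁻¹≈1 ⟨
        t * t⁻¹ * (t⁻¹ * y)                ≈⟨ solve 3 (λ t i y → t :* i :* (i :* y) := y :* t :* (i :* i)) refl t t⁻¹ y ⟩
        y * t * (t⁻¹ * t⁻¹)                ≈⟨ *-congʳ xs≈yt ⟨
        x * s * (t⁻¹ * t⁻¹)                ≈⟨ 1-*ˡ _ ss⁻¹≈1 ⟨
        s * s⁻¹ * (x * s * (t⁻¹ * t⁻¹))    ≈⟨ solve 4 (λ s i x j → s :* i :* (x :* s :* (j :* j)) :=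
                                                i :* x :* (s :* (s :* :1) :* (j :* (j :* :1)))) refl s s⁻¹ x t⁻¹ ⟩
        z * r                              ∎

      -- η cancels without being inverted: (ηs)⁻¹η is an inverse of s, and inverses are unique.
      scaled-quotient : ∀ {s} (s#0 : s # 0#) (ηs#0 : η * s # 0#) u →
        (η * s) ⁻¹[ ηs#0 ] * (η * u) ≈ s ⁻¹[ s#0 ] * u
      scaled-quotient {s} s#0 ηs#0 u = trans (sym (*-assoc _ _ _)) (*-congʳ (inverse-unique {s} refl
        (trans (solve 3 (λ s i η → s :* (i :* η) := η :* s :* i) refl s _ η) (⁻¹-inverseʳ ηs#0))
        (⁻¹-inverseʳ s#0)))

      scaled-square : ∀ {s S} → s ^ 2 ≈ S → (η * s) ^ 2 ≈ h * S
      scaled-square {s} s²≈S = trans (^-distrib-* η s 2) (*-congˡ s²≈S)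

      δ : Carrier
      δ = (1# - (η * s) * (η * x)) ⁻¹[ ηsηx#1 ] * (1# - t * y) ⁻¹[ ty#1 ]

      sx≈ty : s * x ≈ t * y
      sx≈ty = trans (*-comm s x) (trans xs≈yt (*-comm y t))

      -- The scaled denominators agree because both contain η² times sx = ty, the unscaled ones
      -- because sx = ty.
      δ′≈δ : (1# - (η * t) * (η * y)) ⁻¹[ ηtηy#1 ] * (1# - s * x) ⁻¹[ sx#1 ] ≈ δ
      δ′≈δ = *-cong
        (⁻¹-cong ηtηy#1 ηsηx#1 (+-congˡ (-‿cong (begin
          (η * t) * (η * y)   ≈⟨ solve 3 (λ η t y → η :* t :* (η :* y) := η :* η :* (t :* y)) refl η t y ⟩
          η * η * (t * y)     ≈⟨ *-congˡ sx≈ty ⟨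
          η * η * (s * x)     ≈⟨ solve 3 (λ η t y → η :* t :* (η :* y) := η :* η :* (t :* y)) refl η s x ⟨
          (η * s) * (η * x)   ∎))))
        (⁻¹-cong sx#1 ty#1 (+-congˡ (-‿cong sx≈ty)))

      Γ-suc : ∀ m → Γ (suc m) * (1# - q ^ suc m) ≈ Γ m * (r * (1# - T * q ^ m))
      Γ-suc m = begin
        r * r ^ m * ρ′ * u     ≈⟨ *-assoc _ _ _ ⟩
        r * r ^ m * (ρ′ * u)   ≈⟨ *-congˡ (ratio-suc T q q-gen m) ⟩
        r * r ^ m * (ρ * w)    ≈⟨ solve 4 (λ r p ρ w →
                                  r :* p :* (ρ :* w) := p :* ρ :* (r :* w)) refl r (r ^ m) ρ w ⟩
        r ^ m * ρ * (r * w)    ∎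
        where
        ρ ρ′ u w : Carrier
        ρ = ratio T q q-gen m
        ρ′ = ratio T q q-gen (suc m)
        u = 1# - q ^ suc m
        w = 1# - T * q ^ m

      Η-suc : ∀ n → Η (suc n) * (1# - r * T * q ^ n) ≈ Η n * (1# - q ^ suc n)
      Η-suc n = trans (*-congˡ (+-congˡ (-‿cong (*-congʳ (sym s²≈rT))))) (ratio-suc q (s ^ 2) s²-gen n)

      -- If l₁ = b₁ then l₂ = m and nothing moves. Otherwise l₂ and m differ by one, and the factor
      -- 1 - Tq^n or 1 - q^(n+1) needed for one step of Γ is traded between `ν` and `α`.
      Γ-absorbs : ∀ l₁ b₁ {m l₂} → toℕ l₁ ℕ.+ m ≡ toℕ b₁ ℕ.+ l₂ →
        Γ l₂ * ν (z * r) T l₁ b₁ (q ^ l₂) ≈ Γ m * α z r T l₁ b₁ (q ^ m)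
      Γ-absorbs 0F 0F ≡.refl = refl
      Γ-absorbs 1F 0F {m} ≡.refl = Γ-suc m
      Γ-absorbs 0F 1F {_} {l₂} ≡.refl = begin
        Γ l₂ * - (z * r * u)          ≈⟨ *-congˡ (-‿cong (*-assoc z r u)) ⟩
        Γ l₂ * - (z * (r * u))        ≈⟨ *-neg-* _ _ _ ⟩
        - (z * (Γ l₂ * (r * u)))      ≈⟨ -‿cong (*-congˡ (Γ-suc l₂)) ⟨
        - (z * (Γ (suc l₂) * w))      ≈⟨ *-neg-* _ _ _ ⟨
        Γ (suc l₂) * - (z * w)        ∎
        where
        u w : Carrier
        u = 1# - T * q ^ l₂
        w = 1# - q ^ suc l₂
      Γ-absorbs 1F 1F ≡.refl = refl

      -- The same trade for Η, from the summed label l₃ to the fixed label a₃.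
      Η-absorbs : ∀ l₁ b₁ {n l₃} → toℕ l₁ ℕ.+ l₃ ≡ toℕ b₁ ℕ.+ n →
        Η l₃ * ν z (r * T) l₁ b₁ (q ^ n) ≈ Η n * β z (r * T) l₁ b₁ (q ^ l₃)
      Η-absorbs 0F 0F ≡.refl = refl
      Η-absorbs 1F 0F {_} {l₃} ≡.refl = sym (Η-suc l₃)
      Η-absorbs 0F 1F {n} ≡.refl = begin
        Η (suc n) * - (z * u)    ≈⟨ *-neg-* _ _ _ ⟩
        - (z * (Η (suc n) * u))  ≈⟨ -‿cong (*-congˡ (Η-suc n)) ⟩
        - (z * (Η n * w))        ≈⟨ *-neg-* _ _ _ ⟨
        Η n * - (z * w)          ∎
        where
        u w : Carrier
        u = 1# - r * T * q ^ n
        w = 1# - q ^ suc n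
      Η-absorbs 1F 1F ≡.refl = refl

      M N : ℕ
      M = toℕ a₁ ℕ.+ b₃
      N = toℕ b₁ ℕ.+ a₃

      Adm : ℕ → ℕ → Set
      Adm = Admissible M N a₂ b₂

      κ : Carrier
      κ = Γ b₂ * Η a₃ * δ

      lhsValue rhsValue : Fin 2 → ℕ → Carrier
      lhsValue l e = Φ e * (α z r T l b₁ (q ^ b₂) * ν z (h * (r * T)) a₁ l (q ^ (a₂ ℕ.+ e))) * κ
      rhsValue l e = Φ e * (β z (r * T) l b₁ (q ^ (b₂ ℕ.+ e)) * ν (z * r) (h * T) a₁ l (q ^ a₂)) * κ

      -- Truncation yields the default point 0 when l = 0, the fixed bottom or top label is 0 and b₁
      -- or a₁ is 1. No label satisfies conservation then, and `α-zero` or `ν-zero` makes the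
      -- assigned value vanish too.
      lhsPoint rhsPoint : Fin 2 → ℕ
      lhsPoint l = toℕ l ℕ.+ b₂ ∸ toℕ b₁
      rhsPoint l = toℕ l ℕ.+ a₂ ∸ toℕ a₁

      lhs-support : ∀ l l₂ l₃ →
        (∀ e → Adm (toℕ l) e → l₂ ≡ lhsPoint l → l₃ ≡ a₂ ℕ.+ e → ⊥) → lhs l l₂ l₃ ≈ 0#
      lhs-support l l₂ l₃ none = product-zero
        ((a₃ ℕ.+ a₂ ≟ l₃ ℕ.+ l₂) ×-dec (l₂ ≤? a₃)) (M ≟ toℕ l ℕ.+ l₃) (toℕ l ℕ.+ b₂ ≟ toℕ b₁ ℕ.+ l₂)
        (W-zero t s t#0 s²-gen q-gen a₃ a₂ l₃ l₂)
        (w*-zero _ _ ηs#0 ηsηx#1 l₃ l b₃ a₁)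
        (w*-zero _ _ t#0 ty#1 l₂ b₁ b₂ l)
        λ (eW , l₂≤a₃) e₁ e₂ →
          let e , adm , e₃ , e₄ = lhs-admissible (toℕ l) (toℕ b₁) eW l₂≤a₃ e₁ e₂
          in none e adm e₃ e₄

      rhs-support : ∀ l l₂ l₃ →
        (∀ e → Adm (toℕ l) e → l₂ ≡ rhsPoint l → l₃ ≡ b₂ ℕ.+ e → ⊥) → rhs l l₂ l₃ ≈ 0#
      rhs-support l l₂ l₃ none = product-zero
        (toℕ a₁ ℕ.+ l₂ ≟ toℕ l ℕ.+ a₂) (toℕ l ℕ.+ l₃ ≟ N) ((l₃ ℕ.+ l₂ ≟ b₃ ℕ.+ b₂) ×-dec (b₂ ≤? l₃))
        (w*-zero _ _ ηt#0 ηtηy#1 a₂ l l₂ a₁)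
        (λ N≢ → w*-zero _ _ s#0 sx#1 a₃ b₁ l₃ l N≢)
        (W-zero t s t#0 s²-gen q-gen l₃ l₂ b₃ b₂)
        λ e₁ e₂ (eW , b₂≤l₃) →
          let e , adm , e₃ , e₄ = rhs-admissible (toℕ l) (toℕ a₁) eW b₂≤l₃ e₁ e₂
          in none e adm e₃ e₄

      lhs-value-at : ∀ l e l₂ → toℕ l ℕ.+ b₂ ≡ toℕ b₁ ℕ.+ l₂ → Adm (toℕ l) e →
        lhs l l₂ (a₂ ℕ.+ e) ≈ lhsValue l e
      lhs-value-at l e l₂ e₂ (admissible eM eN) = begin
        lhs l l₂ (a₂ ℕ.+ e)
          ≈⟨ *-cong (*-cong
               (W-factor t s t#0 s²-gen q-gen a₃ a₂ (a₂ ℕ.+ e) l₂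
                 (≡.trans (≡.cong (ℕ._+ a₂) a₃≡) (+-rearrange l₂ e a₂))
                 (≡.subst (l₂ ≤_) (≡.sym a₃≡) (ℕ.m≤m+n l₂ e)))
               (w*-ν (η * x) (η * s) ηs#0 ηsηx#1 (a₂ ℕ.+ e) l b₃ a₁
                 (scaled-quotient s#0 ηs#0 x) (scaled-square s²≈rT) eM))
               (w*-ν y t t#0 ty#1 l₂ b₁ b₂ l t⁻¹y≈zr refl e₂) ⟩
        Φ (a₃ ∸ l₂) * Γ l₂ * Η a₃ * (ν₁ * d₁) * (ν₂ * d₂)
          ≡⟨ ≡.cong (λ k → Φ k * Γ l₂ * Η a₃ * (ν₁ * d₁) * (ν₂ * d₂)) (≡.sym (m≡b+n⇒n≡m∸b l₂ a₃≡)) ⟩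
        Φ e * Γ l₂ * Η a₃ * (ν₁ * d₁) * (ν₂ * d₂)
          ≈⟨ solve 7 (λ f g h ν₁ ν₂ d₁ d₂ →
               f :* g :* h :* (ν₁ :* d₁) :* (ν₂ :* d₂) :=
               (g :* ν₂) :* (f :* ν₁ :* (h :* (d₁ :* d₂)))) refl (Φ e) (Γ l₂) (Η a₃) ν₁ ν₂ d₁ d₂ ⟩
        (Γ l₂ * ν₂) * (Φ e * ν₁ * (Η a₃ * δ))
          ≈⟨ *-congʳ (Γ-absorbs l b₁ e₂) ⟩
        (Γ b₂ * α₂) * (Φ e * ν₁ * (Η a₃ * δ))
          ≈⟨ solve 6 (λ g a f ν₁ h d →
               (g :* a) :* (f :* ν₁ :* (h :* d)) := f :* (a :* ν₁) :* (g :* h :* d))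
               refl (Γ b₂) α₂ (Φ e) ν₁ (Η a₃) δ ⟩
        lhsValue l e ∎
        where
        ν₁ ν₂ α₂ d₁ d₂ : Carrier
        ν₁ = ν z (h * (r * T)) a₁ l (q ^ (a₂ ℕ.+ e))
        ν₂ = ν (z * r) T l b₁ (q ^ l₂)
        α₂ = α z r T l b₁ (q ^ b₂)
        d₁ = (1# - (η * s) * (η * x)) ⁻¹[ ηsηx#1 ]
        d₂ = (1# - t * y) ⁻¹[ ty#1 ]
        a₃≡ : a₃ ≡ l₂ ℕ.+ e
        a₃≡ = +-transfer⁻¹ (toℕ l) (toℕ b₁) e₂ eN

      rhs-value-at : ∀ l e l₂ → toℕ a₁ ℕ.+ l₂ ≡ toℕ l ℕ.+ a₂ → Adm (toℕ l) e →
        rhs l l₂ (b₂ ℕ.+ e) ≈ rhsValue l e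
      rhs-value-at l e l₂ e₁ (admissible eM eN) = begin
        rhs l l₂ (b₂ ℕ.+ e)
          ≈⟨ *-cong (*-cong
               (w*-ν (η * y) (η * t) ηt#0 ηtηy#1 a₂ l l₂ a₁
                 (trans (scaled-quotient t#0 ηt#0 y) t⁻¹y≈zr) (scaled-square refl) e₁)
               (w*-ν x s s#0 sx#1 a₃ b₁ (b₂ ℕ.+ e) l refl s²≈rT (≡.sym eN)))
               (W-factor t s t#0 s²-gen q-gen (b₂ ℕ.+ e) l₂ b₃ b₂ eW (ℕ.m≤m+n b₂ e)) ⟩
        (ν₁ * d₁) * (ν₂ * d₂) * (Φ (b₂ ℕ.+ e ∸ b₂) * Γ b₂ * Η (b₂ ℕ.+ e))
          ≡⟨ ≡.cong (λ k → (ν₁ * d₁) * (ν₂ * d₂) * (Φ k * Γ b₂ * Η (b₂ ℕ.+ e))) (ℕ.m+n∸m≡n b₂ e) ⟩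
        (ν₁ * d₁) * (ν₂ * d₂) * (Φ e * Γ b₂ * Η (b₂ ℕ.+ e))
          ≈⟨ solve 7 (λ f g h ν₁ ν₂ d₁ d₂ →
               (ν₁ :* d₁) :* (ν₂ :* d₂) :* (f :* g :* h) :=
               (h :* ν₂) :* (f :* ν₁ :* (g :* (d₁ :* d₂)))) refl (Φ e) (Γ b₂) (Η (b₂ ℕ.+ e)) ν₁ ν₂ d₁ d₂ ⟩
        (Η (b₂ ℕ.+ e) * ν₂) * (Φ e * ν₁ * (Γ b₂ * (d₁ * d₂)))
          ≈⟨ *-cong (Η-absorbs l b₁ (≡.sym eN)) (*-congˡ (*-congˡ δ′≈δ)) ⟩
        (Η a₃ * β₂) * (Φ e * ν₁ * (Γ b₂ * δ))
          ≈⟨ solve 6 (λ h b f ν₁ g d →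
               (h :* b) :* (f :* ν₁ :* (g :* d)) := f :* (b :* ν₁) :* (g :* h :* d))
               refl (Η a₃) β₂ (Φ e) ν₁ (Γ b₂) δ ⟩
        rhsValue l e ∎
        where
        ν₁ ν₂ β₂ d₁ d₂ : Carrier
        ν₁ = ν (z * r) (h * T) a₁ l (q ^ a₂)
        ν₂ = ν z (r * T) l b₁ (q ^ a₃)
        β₂ = β z (r * T) l b₁ (q ^ (b₂ ℕ.+ e))
        d₁ = (1# - (η * t) * (η * y)) ⁻¹[ ηtηy#1 ]
        d₂ = (1# - s * x) ⁻¹[ sx#1 ]
        eW : b₂ ℕ.+ e ℕ.+ l₂ ≡ b₃ ℕ.+ b₂
        eW = ≡.trans (+-rearrange b₂ e l₂)
          (≡.cong (ℕ._+ b₂) (≡.sym (+-transfer⁻¹ (toℕ l) (toℕ a₁) (≡.sym e₁) eM)))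

      1-q⁰≈0 : 1# - q ^ 0 ≈ 0#
      1-q⁰≈0 = -‿inverseʳ 1#

      value-zero : ∀ f k {x} → x ≈ 0# → 0# ≈ f * x * k
      value-zero f k x≈0 = sym (0-*ˡ k (0-*ʳ f x≈0))

      -- The inequality leaves only l = 0, b = 1 and m = 0, where the factor 1 - q^0 is zero. The
      -- same happens in `ν-zero`.
      α-zero : ∀ l b {m} → toℕ l ℕ.+ m < toℕ b → α z r T l b (q ^ m) ≈ 0#
      α-zero 0F 1F {zero} _ = trans (-‿cong (0-*ʳ z 1-q⁰≈0)) ε⁻¹≈ε
      α-zero 0F 1F {suc m} (s≤s ())
      α-zero 1F 1F (s≤s ())

      ν-zero : ∀ l a {m} → toℕ l ℕ.+ m < toℕ a → ν (z * r) (h * T) a l (q ^ m) ≈ 0#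
      ν-zero 0F 1F {zero} _ = 1-q⁰≈0
      ν-zero 0F 1F {suc m} (s≤s ())
      ν-zero 1F 1F (s≤s ())

      lhs-value : ∀ l e → Adm (toℕ l) e → lhs l (lhsPoint l) (a₂ ℕ.+ e) ≈ lhsValue l e
      lhs-value l e adm with toℕ b₁ ≤? toℕ l ℕ.+ b₂
      ... | yes b₁≤ = lhs-value-at l e _ (≡.sym (ℕ.m+[n∸m]≡n b₁≤)) adm
      ... | no b₁≰ = trans
        (0-*ʳ _ (w*-zero y t t#0 ty#1 _ b₁ b₂ l λ e₂ → b₁≰ (≡.subst (toℕ b₁ ≤_) (≡.sym e₂) (ℕ.m≤m+n _ _))))
        (value-zero (Φ e) κ (0-*ˡ _ (α-zero l b₁ (ℕ.≰⇒> b₁≰))))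

      rhs-value : ∀ l e → Adm (toℕ l) e → rhs l (rhsPoint l) (b₂ ℕ.+ e) ≈ rhsValue l e
      rhs-value l e adm with toℕ a₁ ≤? toℕ l ℕ.+ a₂
      ... | yes a₁≤ = rhs-value-at l e _ (ℕ.m+[n∸m]≡n a₁≤) adm
      ... | no a₁≰ = trans
        (0-*ˡ _ (0-*ˡ _ (w*-zero (η * y) (η * t) ηt#0 ηtηy#1 a₂ l _ a₁
          λ e₁ → a₁≰ (≡.subst (toℕ a₁ ≤_) e₁ (ℕ.m≤m+n _ _)))))
        (value-zero (Φ e) κ (0-*ʳ _ (ν-zero l a₁ (ℕ.≰⇒> a₁≰))))

      -- One box must hold both coordinates. On the left l₂ is at most 1 + b₂ and l₃ at most `M`, on
      -- the right 1 + a₂ and `N`; the sum of the two labels plus 2 exceeds both.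
      point-bound : ∀ (l : Fin 2) m b k → toℕ l ℕ.+ m ∸ b < suc (suc (m ℕ.+ k))
      point-bound l m b k = s≤s (ℕ.≤-trans (ℕ.m∸n≤m _ b)
        (ℕ.+-mono-≤ (s≤s⁻¹ (toℕ<n l)) (ℕ.m≤m+n m k)))

      row-bound : ∀ l o m {k} → k ≡ l ℕ.+ o → o < suc (suc (m ℕ.+ k))
      row-bound l o m ≡.refl = s≤s (ℕ.m≤n⇒m≤1+n (ℕ.≤-trans (ℕ.m≤n+m o l) (ℕ.m≤n+m _ m)))

      both-values : ∀ c → rhsValue 0F (suc c) + rhsValue 1F c ≈ lhsValue 0F (suc c) + lhsValue 1F c
      both-values c = begin
        rhsValue 0F (suc c) + rhsValue 1F c   ≈⟨ distribʳ κ _ _ ⟨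
        (Φ (suc c) * (β z (r * T) 0F b₁ (q ^ (b₂ ℕ.+ suc c)) * ν′₀)
          + Φ c * (β z (r * T) 1F b₁ (q ^ (b₂ ℕ.+ c)) * ν′₁)) * κ
          ≈⟨ *-congʳ (+-cong
               (*-congˡ (*-congʳ (β-cong 0F b₁ (^-homo-* q b₂ (suc c)))))
               (*-congˡ (*-congʳ (β-cong 1F b₁ (^-homo-* q b₂ c))))) ⟩
        (Φ (suc c) * (β z (r * T) 0F b₁ (q ^ b₂ * q ^ suc c) * ν′₀)
          + Φ c * (β z (r * T) 1F b₁ (q ^ b₂ * q ^ c) * ν′₁)) * κ
          -- As `q ^ suc c` unfolds to `q * q ^ c`, the recurrence of Φ is literally the hypothesis
          -- of `exchange`.
          ≈⟨ *-congʳ (exchange z r T h a₁ b₁ (q ^ b₂) (q ^ a₂) (q ^ c) (q ^ suc c) (Φ c) (Φ (suc c))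
               (ratio-suc r q q-gen c)) ⟨
        (Φ (suc c) * (α₀ * ν z (h * (r * T)) a₁ 0F (q ^ a₂ * q ^ suc c))
          + Φ c * (α₁ * ν z (h * (r * T)) a₁ 1F (q ^ a₂ * q ^ c))) * κ
          ≈⟨ *-congʳ (+-cong
               (*-congˡ (*-congˡ (ν-cong a₁ 0F (^-homo-* q a₂ (suc c)))))
               (*-congˡ (*-congˡ (ν-cong a₁ 1F (^-homo-* q a₂ c))))) ⟨
        (Φ (suc c) * (α₀ * ν z (h * (r * T)) a₁ 0F (q ^ (a₂ ℕ.+ suc c)))
          + Φ c * (α₁ * ν z (h * (r * T)) a₁ 1F (q ^ (a₂ ℕ.+ c)))) * κ
          ≈⟨ distribʳ κ _ _ ⟩
        lhsValue 0F (suc c) + lhsValue 1F c   ∎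
        where
        ν′₀ ν′₁ α₀ α₁ : Carrier
        ν′₀ = ν (z * r) (h * T) a₁ 0F (q ^ a₂)
        ν′₁ = ν (z * r) (h * T) a₁ 1F (q ^ a₂)
        α₀ = α z r T 0F b₁ (q ^ b₂)
        α₁ = α z r T 1F b₁ (q ^ b₂)

      single-value : rhsValue 0F 0 ≈ lhsValue 0F 0
      single-value = *-congʳ (*-congˡ (begin
        β z (r * T) 0F b₁ (q ^ (b₂ ℕ.+ 0)) * ν (z * r) (h * T) a₁ 0F (q ^ a₂)
          ≡⟨ ≡.cong (λ k → β z (r * T) 0F b₁ (q ^ k) * ν (z * r) (h * T) a₁ 0F (q ^ a₂)) (ℕ.+-identityʳ b₂) ⟩
        β z (r * T) 0F b₁ (q ^ b₂) * ν (z * r) (h * T) a₁ 0F (q ^ a₂)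
          ≈⟨ edge-identity z r T h a₁ b₁ (q ^ b₂) (q ^ a₂) ⟨
        α z r T 0F b₁ (q ^ b₂) * ν z (h * (r * T)) a₁ 0F (q ^ a₂)
          ≡⟨ ≡.cong (λ k → α z r T 0F b₁ (q ^ b₂) * ν z (h * (r * T)) a₁ 0F (q ^ k)) (ℕ.+-identityʳ a₂) ⟨
        α z r T 0F b₁ (q ^ b₂) * ν z (h * (r * T)) a₁ 0F (q ^ (a₂ ℕ.+ 0)) ∎))

      module Lhs = OnePointSummands lhs lhsValue M N a₂ b₂ lhsPoint a₂ (suc (suc (b₂ ℕ.+ M)))
        (λ l → point-bound l b₂ (toℕ b₁) M)
        (λ l e (admissible eM _) → row-bound (toℕ l) _ b₂ eM) lhs-support lhs-value

      module Rhs = OnePointSummands rhs rhsValue M N a₂ b₂ rhsPoint b₂ (suc (suc (a₂ ℕ.+ N)))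
        (λ l → point-bound l a₂ (toℕ a₁) N)
        (λ l e (admissible _ eN) → row-bound (toℕ l) _ a₂ eN) rhs-support rhs-value

    -- The exponent at l₁ = 0 governs the cases: without one every term vanishes, at 0 only l₁ = 0
    -- contributes, and at c + 1 the value l₁ = 1 joins with exponent c.
    yang-baxter : ∃[ v ] SumsTo lhs v × SumsTo rhs v
    yang-baxter with admissible? M N a₂ b₂
    ... | no none = 0# ,
      Lhs.sumsTo-none (λ e adm → none (e , adm)) ,
      Rhs.sumsTo-none (λ e adm → none (e , adm))
    ... | yes (zero , adm) = lhsValue 0F 0 ,
      Lhs.sumsTo-single adm ,
      SumsTo-≈ single-value (Rhs.sumsTo-single adm)
    ... | yes (suc c , adm) = lhsValue 0F (suc c) + lhsValue 1F c ,
      Lhs.sumsTo-both c adm ,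
      SumsTo-≈ (both-values c) (Rhs.sumsTo-both c adm)

proposition3p2 :
  ∀ {c ℓ₁ ℓ₂} (F : HeytingField c ℓ₁ ℓ₂) (q : HeytingField.Carrier F) →
  let open HeytingField F
      open Weights F q
  in
  (η x y s t : Carrier) →
  x * s ≈ y * t →
  (q-gen : Generic q) (s²-gen : Generic (s ^ 2)) →
  (s#0 : s # 0#) (t#0 : t # 0#) (ηs#0 : η * s # 0#) (ηt#0 : η * t # 0#) →
  (sx#1 : 1# - s * x # 0#) (ty#1 : 1# - t * y # 0#) →
  (ηsηx#1 : 1# - (η * s) * (η * x) # 0#) →
  (ηtηy#1 : 1# - (η * t) * (η * y) # 0#) →
  (a₁ b₁ : Fin 2) (a₂ a₃ b₂ b₃ : ℕ) →
  ∃[ v ]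
    SumsTo (λ l₁ l₂ l₃ →
        W t s t#0 s²-gen q-gen a₃ a₂ l₃ l₂
      * w* (η * x) (η * s) ηs#0 ηsηx#1 l₃ l₁ b₃ a₁
      * w* y t t#0 ty#1 l₂ b₁ b₂ l₁) v
  × SumsTo (λ l₁ l₂ l₃ →
        w* (η * y) (η * t) ηt#0 ηtηy#1 a₂ l₁ l₂ a₁
      * w* x s s#0 sx#1 a₃ b₁ l₃ l₁
      * W t s t#0 s²-gen q-gen l₃ l₂ b₃ b₂) v
proposition3p2 = VertexWeights.yang-baxter
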